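{- For an integer $m\ge 0$ let $\mathbf{S}_m=\{1,\dots,m\}^2$ (empty for $m=0$). Two squares $(i,j),(i',j')$ are said to be on a common diagonal if $i-j=i'-j'$ or $i+j=i'+j'$. Let $R_{\mathbf{W}}(m,k)$ be the number of $k$-element subsets of $\{(i,j)\in\mathbf{S}_m: i+j \text{ even}\}$ with no two distinct elements on a common diagonal, and let $R_{\mathbf{K}}(m,k)$ be the analogous number for $\{(i,j)\in\mathbf{S}_m: i+j\text{ odd}\}$ (i.e., nonattacking placements of $k$ bishops on the white, resp. black, squares). Let $\pi(m)=1$ if $m$ is odd and $0$ otherwise. Then, for all integers $m\ge 1$ and $k\ge 1$, $$R_{\mathbf{W}}(m,k)=R_{\mathbf{W}}(m-1,k)+(m-k+\pi(m))R_{\mathbf{W}}(m-1,k-1),$$ $$R_{\mathbf{K}}(m,k)=R_{\mathbf{K}}(m-1,k)+(m-k+1-\pi(m))R_{\mathbf{K}}(m-1,k-1),$$ with $R_{\mathbf{W}}(m,0)=R_{\mathbf{K}}(m,0)=1$ and $R_{\mathbf{W}}(0,k)=R_{\mathbf{K}}(0,k)=\delta_{k0}$; moreover, for all integers $m,k\ge 0$, $$R_{\mathbf{W}}(m,k)=\sum_{j=0}^{k}\binom{\lceil m/2\rceil}{j}\left\{ {m-j \atop m-k}\right\},\qquad R_{\mathbf{K}}(m,k)=\sum_{j=0}^{k}\binom{\lfloor m/2\rfloor}{j}\left\{ {m-j \atop m-k}\right\}.$$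
   Context: $\delta_{ij}$ is the Kronecker delta. The Stirling numbers of the second kind $\left\{ {n \atop r}\right\}$ are used in the extended sense for all integers $n,r$: for $n,r\ge 0$ they are the usual Stirling numbers of the second kind; for $n,r\le 0$, $\left\{ {n \atop r}\right\}=\left[{ -r \atop -n}\right]$, the unsigned Stirling number of the first kind; and $\left\{ {n \atop r}\right\}=0$ when one of $n,r$ is positive and the other negative. (Equivalently, the unique extension satisfying $\left\{ {n \atop r}\right\}=r\left\{ {n-1 \atop r}\right\}+\left\{ {n-1 \atop r-1}\right\}$ for all integers, as in Knuth's convention.) Binomial coefficients $\binom{x}{j}$ with integer $j\ge0$ are $x(x-1)\cdots(x-j+1)/j!$. -}

module Defs where

open import Data.Bool.Base using (if_then_else_)
open import Data.Integer.Base using (ℤ; +_; -[1+_]; _-_)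
import Data.Integer.Properties as ℤ
open import Data.List.Base using (List; []; _∷_; _++_; map; filter; length; applyUpTo; cartesianProduct)
open import Data.List.Relation.Unary.AllPairs using (AllPairs; allPairs?)
open import Data.Nat.Base using (ℕ; zero; suc; _+_; _*_)
open import Data.Nat.Divisibility using (_∣_; _∣?_)
open import Data.Nat.ListAction using (sum)
open import Data.Nat.Properties using (_≟_)
open import Data.Product.Base using (_×_; _,_)
open import Data.Sum.Base using (_⊎_)
open import Relation.Binary.Definitions using (Decidable)
open import Relation.Binary.PropositionalEquality using (_≡_)
open import Relation.Nullary using (¬_; does; ¬?; _⊎-dec_)
import Relation.Unary as U

δ : ℕ → ℕ → ℕ
δ i j = if does (i ≟ j) then 1 else 0

π : ℕ → ℕ
π m = if does (2 ∣? m) then 0 else 1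

-- Both bounds are inclusive: Σ[0⋯ k ] f = f 0 + f 1 + … + f k.
Σ[0⋯_] : ℕ → (ℕ → ℕ) → ℕ
Σ[0⋯ k ] f = sum (applyUpTo f (suc k))

Square : Set
Square = ℕ × ℕ

-- Coordinates run from 1 to m; every square is listed exactly once.
squares : ℕ → List Square
squares m = cartesianProduct (applyUpTo suc m) (applyUpTo suc m)

Even Odd : Square → Set
Even (i , j) = 2 ∣ i + j
Odd  (i , j) = ¬ (2 ∣ i + j)

even? : U.Decidable Even
even? (i , j) = 2 ∣? i + j

odd? : U.Decidable Odd
odd? (i , j) = ¬? (2 ∣? i + j)

white black : ℕ → List Square
white m = filter even? (squares m)
black m = filter odd?  (squares m)

CommonDiagonal : Square → Square → Set
CommonDiagonal (i , j) (i′ , j′) =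
  (+ i - + j ≡ + i′ - + j′) ⊎ (i + j ≡ i′ + j′)

commonDiagonal? : Decidable CommonDiagonal
commonDiagonal? (i , j) (i′ , j′) =
  ((+ i - + j) ℤ.≟ (+ i′ - + j′)) ⊎-dec (i + j ≟ i′ + j′)

-- The k-element subsets of a duplicate-free list, each represented once, by
-- the sublist of its elements in the order of the list.
subsets : ∀ {a} {A : Set a} → ℕ → List A → List (List A)
subsets zero    xs       = [] ∷ []
subsets (suc k) []       = []
subsets (suc k) (x ∷ xs) = map (x ∷_) (subsets k xs) ++ subsets (suc k) xs

-- AllPairs ranges over pairs of entries at different positions, which in a
-- duplicate-free list are the pairs of distinct elements.
NonAttacking : List Square → Set
NonAttacking = AllPairs (λ s t → ¬ CommonDiagonal s t)

nonAttacking? : U.Decidable NonAttacking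
nonAttacking? = allPairs? (λ s t → ¬? (commonDiagonal? s t))

placements : List Square → ℕ → ℕ
placements B k = length (filter nonAttacking? (subsets k B))

R-W R-K : ℕ → ℕ → ℕ
R-W m k = placements (white m) k
R-K m k = placements (black m) k

stirling₁ : ℕ → ℕ → ℕ
stirling₁ zero    zero    = 1
stirling₁ zero    (suc r) = 0
stirling₁ (suc n) zero    = 0
stirling₁ (suc n) (suc r) = n * stirling₁ n (suc r) + stirling₁ n r

stirling₂ : ℕ → ℕ → ℕ
stirling₂ zero    zero    = 1
stirling₂ zero    (suc r) = 0
stirling₂ (suc n) zero    = 0
stirling₂ (suc n) (suc r) = suc r * stirling₂ n (suc r) + stirling₂ n r

-- Second kind, extended to all integers as in Knuth: for n, r ≤ 0 the value is
-- the unsigned first-kind number stirling₁ (- r) (- n), and it is 0 when n and r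
-- have opposite nonzero signs.
stirling : ℤ → ℤ → ℕ
stirling (+ n)     (+ r)     = stirling₂ n r
stirling (+ zero)  -[1+ r ]  = stirling₁ (suc r) zero
stirling (+ suc n) -[1+ r ]  = 0
stirling -[1+ n ]  (+ zero)  = stirling₁ zero (suc n)
stirling -[1+ n ]  (+ suc r) = 0
stirling -[1+ n ]  -[1+ r ]  = stirling₁ (suc r) (suc n)

{-# OPTIONS --safe #-}
module Submission where

-- On squares of one colour, bishops are rooks on the board whose rows and columns
-- are the two families of diagonals. Cutting the colour class along a longest
-- difference-diagonal (i = j on white, i = j + 1 on black) and pushing its two sides
-- together gives the opposite colour class of the (m − 1)-board, with the same
-- attacks; and the removed row meets every remaining column. The rook recurrence
-- for adding a full row therefore gives
--   W(m+1, k+1) = K(m, k+1) + (m + 1 − k) K(m, k),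
--   K(m+1, k+1) = W(m, k+1) + (m − k) W(m, k).
-- The Stirling sums satisfy the same two recurrences by the recurrences of the
-- Stirling numbers and Pascal's rule, which proves the closed forms. These coincide
-- for even m, so W(m, k) = K(m, k) there, and the colours can be interchanged to
-- obtain the recurrences within one colour.

open import Defs
open import Data.Bool.Base using (true; false; _∧_; if_then_else_)
open import Data.Integer.Base using (+_; -[1+_]; _-_) renaming (_+_ to _+ℤ_; _*_ to _*ℤ_)
import Data.Integer.Properties as ℤ
open import Data.Integer.Tactic.RingSolver using () renaming (solve-∀ to ℤ-solve-∀)
open import Data.List.Base using (List; []; _∷_; _++_; map; filter; length; applyUpTo)
open import Data.List.Membership.Propositional using (_∈_)
open import Data.List.Membership.Propositional.Properties using (∈-map⁺; ∈-map⁻; ∈-++⁺ˡ; ∈-++⁺ʳ; ∈-++⁻; ∈-filter⁺; ∈-filter⁻; ∈-applyUpTo⁺; ∈-applyUpTo⁻; ∈-cartesianProduct⁺; ∈-cartesianProduct⁻)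
open import Data.List.Membership.Propositional.Properties.WithK using (unique∧set⇒bag)
open import Data.List.Properties using (length-++; length-map; length-applyUpTo; filter-++; filter-≐; filter-accept; filter-reject; filter-all; filter-none; map-∘; map-cong-local; map-applyUpTo)
open import Data.List.Relation.Binary.BagAndSetEquality using (∼bag⇒↭)
open import Data.List.Relation.Binary.Permutation.Propositional as ↭ using (_↭_; refl; prep; swap)
open import Data.List.Relation.Binary.Permutation.Propositional.Properties using (filter-↭)
open import Data.List.Relation.Unary.All as All using (All; []; _∷_; all?)
open import Data.List.Relation.Unary.AllPairs using (AllPairs; []; _∷_; allPairs?)
import Data.List.Relation.Unary.AllPairs.Properties as AllPairs
open import Data.List.Relation.Unary.Any using (here; there)
open import Data.List.Relation.Unary.Unique.Propositional using (Unique)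
import Data.List.Relation.Unary.Unique.Propositional.Properties as Unique
open import Data.Nat.Base using (ℕ; zero; suc; _+_; _*_; _∸_; _≤_; _<_; z≤n; s≤s; ⌊_/2⌋; ⌈_/2⌉)
open import Data.Nat.Combinatorics using (_C_; nCn≡1; nCk≡nC[n∸k]; k>n⇒nCk≡0; nCk+nC[k+1]≡[n+1]C[k+1])
open import Data.Nat.Divisibility using (_∣_; _∣?_; divides; _∣0; ∣-refl; ∣1⇒≡1; ∣m+n∣m⇒∣n; ∣m∣n⇒∣m+n)
open import Data.Nat.ListAction using (sum)
open import Data.Nat.Properties
open import Algebra.Properties.CommutativeSemigroup +-commutativeSemigroup using (x∙yz≈y∙xz; xy∙z≈xz∙y; interchange)
open import Data.Nat.Tactic.RingSolver using (solve-∀)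
open import Data.Product.Base using (_×_; _,_; proj₁; proj₂; ∃-syntax)
open import Data.Sum.Base using (inj₁; inj₂; [_,_]′)
open import Function.Base using (_∘_)
open import Function.Bundles using (mk⇔)
open import Relation.Binary.Definitions using (Decidable; Symmetric; tri<; tri≈; tri>)
open import Relation.Binary.PropositionalEquality using (_≡_; _≢_; refl; sym; trans; cong; cong₂; subst; module ≡-Reasoning)
open import Relation.Nullary using (¬_; ¬?; does; yes; no; contradiction)
open import Relation.Nullary.Decidable using (dec-true; dec-false)
import Relation.Unary as U

-- Filtering lists and lists of subsets

filter-map : ∀ {A B : Set} {P : B → Set} (P? : U.Decidable P) (f : A → B) xs →
             filter P? (map f xs) ≡ map f (filter (P? ∘ f) xs)
filter-map P? f []       = refl
filter-map P? f (x ∷ xs) with does (P? (f x))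
... | true  = cong (f x ∷_) (filter-map P? f xs)
... | false = filter-map P? f xs

-- The hypothesis speaks of the Booleans `does` because `allPairs?` on `x ∷ ys` computes to such a
-- conjunction, so `count-∷` can supply it by `refl`.
filter-∧ : ∀ {A : Set} {P Q R : A → Set} (P? : U.Decidable P) (Q? : U.Decidable Q) (R? : U.Decidable R) →
           (∀ x → does (R? x) ≡ does (Q? x) ∧ does (P? x)) →
           ∀ xs → filter R? xs ≡ filter P? (filter Q? xs)
filter-∧ P? Q? R? eq []       = refl
filter-∧ P? Q? R? eq (x ∷ xs) rewrite eq x with does (Q? x)
... | false = filter-∧ P? Q? R? eq xs
... | true with does (P? x)
...   | true  = cong (x ∷_) (filter-∧ P? Q? R? eq xs)
...   | false = filter-∧ P? Q? R? eq xs

filter-comm : ∀ {A : Set} {P Q : A → Set} (P? : U.Decidable P) (Q? : U.Decidable Q) xs →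
              filter P? (filter Q? xs) ≡ filter Q? (filter P? xs)
filter-comm P? Q? []       = refl
filter-comm P? Q? (x ∷ xs) with does (P? x) in p | does (Q? x) in q
... | true  | true  rewrite p | q = cong (x ∷_) (filter-comm P? Q? xs)
... | true  | false rewrite q     = filter-comm P? Q? xs
... | false | true  rewrite p     = filter-comm P? Q? xs
... | false | false               = filter-comm P? Q? xs

-- If `P x` holds, testing `x ∷ ys` amounts to testing `ys`; otherwise no subset through `x`
-- survives.
filter-all-subsets : ∀ {A : Set} {P : A → Set} (P? : U.Decidable P) k xs →
                     filter (all? P?) (subsets k xs) ≡ subsets k (filter P? xs)
filter-all-subsets P? zero    xs       = refl
filter-all-subsets P? (suc k) []       = refl
filter-all-subsets P? (suc k) (x ∷ xs)
  rewrite filter-++ (all? P?) (map (x ∷_) (subsets k xs)) (subsets (suc k) xs)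
        | filter-map (all? P?) (x ∷_) (subsets k xs)
        | filter-all-subsets P? (suc k) xs
  with P? x
... | yes px = cong (λ z → map (x ∷_) z ++ subsets (suc k) (filter P? xs))
    (trans (filter-≐ _ (all? P?) (All.tail , px All.∷_) (subsets k xs)) (filter-all-subsets P? k xs))
... | no ¬px = cong (λ z → map (x ∷_) z ++ subsets (suc k) (filter P? xs))
    (filter-none _ (All.universal (λ ys → ¬px ∘ All.head) (subsets k xs)))

length-remove : ∀ {v} {cs : List ℕ} → Unique cs → v ∈ cs →
                length cs ≡ suc (length (filter (λ c → ¬? (c ≟ v)) cs))
length-remove {v} {c ∷ cs} (c∉ ∷ u) (here refl) = cong suc (sym (trans
  (cong length (filter-reject (λ d → ¬? (d ≟ v)) (λ c≢c → c≢c refl)))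
  (cong length (filter-all (λ d → ¬? (d ≟ v)) (All.map (λ c≢d → c≢d ∘ sym) c∉)))))
length-remove {v} {c ∷ cs} (c∉ ∷ u) (there v∈) = cong suc (trans (length-remove u v∈)
  (sym (cong length (filter-accept (λ d → ¬? (d ≟ v)) (All.lookup c∉ v∈)))))

-- Counting pairwise compatible subsets

module _ {A : Set} {R : A → A → Set} (R? : Decidable R) where

  -- For `R` the non-attacking relation this unfolds to `placements`.
  count : ℕ → List A → ℕ
  count k xs = length (filter (allPairs? R?) (subsets k xs))

  -- Split on whether `x` is used: if it is, the other `k` elements come from those compatible with
  -- `x`.
  count-∷ : ∀ k x xs → count (suc k) (x ∷ xs) ≡ count k (filter (R? x) xs) + count (suc k) xs
  count-∷ k x xs = begin
    length (filter (allPairs? R?) (map (x ∷_) (subsets k xs) ++ subsets (suc k) xs))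
      ≡⟨ cong length (filter-++ (allPairs? R?) (map (x ∷_) (subsets k xs)) (subsets (suc k) xs)) ⟩
    length (filter (allPairs? R?) (map (x ∷_) (subsets k xs)) ++ _)
      ≡⟨ length-++ (filter (allPairs? R?) (map (x ∷_) (subsets k xs))) ⟩
    length (filter (allPairs? R?) (map (x ∷_) (subsets k xs))) + count (suc k) xs
      ≡⟨ cong (_+ count (suc k) xs) (begin
        length (filter (allPairs? R?) (map (x ∷_) (subsets k xs)))
          ≡⟨ cong length (filter-map (allPairs? R?) (x ∷_) (subsets k xs)) ⟩
        length (map (x ∷_) (filter (allPairs? R? ∘ (x ∷_)) (subsets k xs)))
          ≡⟨ length-map (x ∷_) (filter (allPairs? R? ∘ (x ∷_)) (subsets k xs)) ⟩
        length (filter (allPairs? R? ∘ (x ∷_)) (subsets k xs))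
          ≡⟨ cong length (filter-∧ (allPairs? R?) (all? (R? x)) (allPairs? R? ∘ (x ∷_)) (λ _ → refl) (subsets k xs)) ⟩
        length (filter (allPairs? R?) (filter (all? (R? x)) (subsets k xs)))
          ≡⟨ cong (length ∘ filter (allPairs? R?)) (filter-all-subsets (R? x) k xs) ⟩
        count k (filter (R? x) xs) ∎) ⟩
    count k (filter (R? x) xs) + count (suc k) xs ∎
    where open ≡-Reasoning

  module _ (R-sym : Symmetric R) where

    private
      -- The case of an adjacent transposition. If `x` and `y` are compatible, the subsets using
      -- both are counted by filtering for `x` and `y` in either order; if not, there are none.
      -- Symmetry excludes the mixed cases.
      pair : ∀ k x y zs →
             count k (filter (R? x) (y ∷ zs)) + (count k (filter (R? y) zs) + count (suc k) zs) ≡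
             count k (filter (R? y) (x ∷ zs)) + (count k (filter (R? x) zs) + count (suc k) zs)
      pair zero    x y zs = refl
      pair (suc k) x y zs with R? x y | R? y x
      ... | yes r  | no ¬r  = contradiction (R-sym r) ¬r
      ... | no ¬r  | yes r  = contradiction (R-sym r) ¬r
      ... | no _   | no _   = x∙yz≈y∙xz (count (suc k) (filter (R? x) zs)) (count (suc k) (filter (R? y) zs)) (count (suc (suc k)) zs)
      ... | yes _  | yes _
        rewrite count-∷ k y (filter (R? x) zs) | count-∷ k x (filter (R? y) zs)
              | filter-comm (R? x) (R? y) zs =
        interchange (count k (filter (R? y) (filter (R? x) zs))) (count (suc k) (filter (R? x) zs))
               (count (suc k) (filter (R? y) zs)) (count (suc (suc k)) zs)

    -- Induction on `k` first, then on the permutation: wherever the permutation is filtered, and so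
    -- is no longer a subterm, the size has dropped.
    count-↭ : ∀ k {xs ys} → xs ↭ ys → count k xs ≡ count k ys
    count-↭ zero    _                       = refl
    count-↭ (suc k) refl                    = refl
    count-↭ (suc k) (prep {xs} {ys} x p)    = begin
      count (suc k) (x ∷ xs)                         ≡⟨ count-∷ k x xs ⟩
      count k (filter (R? x) xs) + count (suc k) xs
        ≡⟨ cong₂ _+_ (count-↭ k (filter-↭ (R? x) p)) (count-↭ (suc k) p) ⟩
      count k (filter (R? x) ys) + count (suc k) ys  ≡⟨ count-∷ k x ys ⟨
      count (suc k) (x ∷ ys)                         ∎
      where open ≡-Reasoning
    count-↭ (suc k) (swap {xs} {ys} x y p)  = begin
      count (suc k) (x ∷ y ∷ xs)
        ≡⟨ trans (count-∷ k x (y ∷ xs)) (cong (λ n → count k (filter (R? x) (y ∷ xs)) + n) (count-∷ k y xs)) ⟩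
      count k (filter (R? x) (y ∷ xs)) + (count k (filter (R? y) xs) + count (suc k) xs)
        ≡⟨ pair k x y xs ⟩
      count k (filter (R? y) (x ∷ xs)) + (count k (filter (R? x) xs) + count (suc k) xs)
        ≡⟨ cong₂ _+_ (count-↭ k (filter-↭ (R? y) (prep x p)))
                     (cong₂ _+_ (count-↭ k (filter-↭ (R? x) p)) (count-↭ (suc k) p)) ⟩
      count k (filter (R? y) (x ∷ ys)) + (count k (filter (R? x) ys) + count (suc k) ys)
        ≡⟨ trans (count-∷ k y (x ∷ ys)) (cong (λ n → count k (filter (R? y) (x ∷ ys)) + n) (count-∷ k x ys)) ⟨
      count (suc k) (y ∷ x ∷ ys) ∎
      where open ≡-Reasoning
    count-↭ (suc k) (↭.trans p q)           = trans (count-↭ (suc k) p) (count-↭ (suc k) q)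

  count-map : ∀ (f : A → A) → (∀ {x y} → R (f x) (f y) → R x y) → (∀ {x y} → R x y → R (f x) (f y)) →
              ∀ k xs → count k (map f xs) ≡ count k xs
  count-map f reflects preserves zero    xs       = refl
  count-map f reflects preserves (suc k) []       = refl
  count-map f reflects preserves (suc k) (x ∷ xs) = begin
    count (suc k) (f x ∷ map f xs)
      ≡⟨ count-∷ k (f x) (map f xs) ⟩
    count k (filter (R? (f x)) (map f xs)) + count (suc k) (map f xs)
      ≡⟨ cong (λ ys → count k ys + count (suc k) (map f xs)) (trans (filter-map (R? (f x)) f xs)
           (cong (map f) (filter-≐ (R? (f x) ∘ f) (R? x) (reflects , preserves) xs))) ⟩
    count k (map f (filter (R? x) xs)) + count (suc k) (map f xs)
      ≡⟨ cong₂ _+_ (count-map f reflects preserves k (filter (R? x) xs))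
                   (count-map f reflects preserves (suc k) xs) ⟩
    count k (filter (R? x) xs) + count (suc k) xs
      ≡⟨ count-∷ k x xs ⟨
    count (suc k) (x ∷ xs) ∎
    where open ≡-Reasoning

  -- At most one element of `row` can be used, since choosing it filters out all the others.
  count-++-clique : ∀ k row rest → AllPairs (λ x y → ¬ R x y) row →
    count (suc k) (row ++ rest) ≡ sum (map (λ x → count k (filter (R? x) rest)) row) + count (suc k) rest
  count-++-clique k []        rest _        = refl
  count-++-clique k (x ∷ row) rest (¬r ∷ c)
    rewrite count-∷ k x (row ++ rest) | filter-++ (R? x) row rest | filter-none (R? x) ¬r
          | count-++-clique k row rest c =
    sym (+-assoc (count k (filter (R? x) rest)) _ _)

  -- `κ` gives the column of a rook; for bishops it is instantiated with `antidiagonal`. The row is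
  -- a separate list of mutually attacking elements.
  module _ (κ : A → ℕ) (R⇒≢ : ∀ {x y} → R x y → κ x ≢ κ y) where

    avoiding : ℕ → List A → List A
    avoiding c = filter (λ z → ¬? (c ≟ κ z))

    avoided : ℕ → List A → List ℕ → ℕ
    avoided k ys cs = sum (map (λ c → count k (avoiding c ys)) cs)

    private
      -- For a column other than that of `y`, split on whether `y` is used. Avoiding the column of
      -- `y` discards `y`, so this column gives no term with `y` used.
      avoid-∷ : ∀ k y ys cs → avoided (suc k) (y ∷ ys) cs ≡
        avoided k (filter (R? y) ys) (filter (λ c → ¬? (c ≟ κ y)) cs) + avoided (suc k) ys cs
      avoid-∷ k y ys []       = refl
      avoid-∷ k y ys (c ∷ cs) with c ≟ κ y
      ... | yes c≡κy
        rewrite filter-reject (λ z → ¬? (c ≟ κ z)) {xs = ys} (λ c≢κy → c≢κy c≡κy)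
              | filter-reject (λ c → ¬? (c ≟ κ y)) {xs = cs} (λ c≢κy → c≢κy c≡κy)
              | avoid-∷ k y ys cs =
        x∙yz≈y∙xz (count (suc k) (avoiding c ys)) (avoided k (filter (R? y) ys) (filter (λ c → ¬? (c ≟ κ y)) cs)) (avoided (suc k) ys cs)
      ... | no c≢κy
        rewrite filter-accept (λ z → ¬? (c ≟ κ z)) {xs = ys} c≢κy
              | filter-accept (λ c → ¬? (c ≟ κ y)) {xs = cs} c≢κy
              | count-∷ k y (avoiding c ys) | avoid-∷ k y ys cs
              | filter-comm (R? y) (λ z → ¬? (c ≟ κ z)) ys =
        interchange (count k (avoiding c (filter (R? y) ys))) (count (suc k) (avoiding c ys)) (avoided k (filter (R? y) ys) (filter (λ c → ¬? (c ≟ κ y)) cs)) (avoided (suc k) ys cs)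

    -- Double counting: each placement of k rooks occupies exactly k of the columns cs.
    sum-avoiding : ∀ k ys cs → Unique cs → All (λ y → κ y ∈ cs) ys →
      avoided k ys cs + k * count k ys ≡ length cs * count k ys
    sum-avoiding zero    ys cs u a = ones cs
      where
      ones : ∀ (cs : List ℕ) → sum (map (λ c → 1) cs) + 0 ≡ length cs * 1
      ones []       = refl
      ones (c ∷ cs) = cong suc (ones cs)
    sum-avoiding (suc k) [] cs u a = zeros cs
      where
      zeros : ∀ (cs : List ℕ) → sum (map (λ c → 0) cs) + suc k * 0 ≡ length cs * 0
      zeros []       = *-zeroʳ k
      zeros (c ∷ cs) = zeros cs
    sum-avoiding (suc k) (y ∷ ys) cs u (κy∈ ∷ a) = begin
      avoided (suc k) (y ∷ ys) cs + suc k * count (suc k) (y ∷ ys)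
        ≡⟨ cong₂ (λ p q → p + suc k * q) (avoid-∷ k y ys cs) (count-∷ k y ys) ⟩
      (X + Y) + suc k * (N₁ + N₂)       ≡⟨ rearrange X Y k N₁ N₂ ⟩
      (X + k * N₁ + N₁) + (Y + suc k * N₂)
        -- When `y` is used, the other `k` elements lie in the columns `cs′`; the spare `N₁`
        -- accounts for the column of `y`.
        ≡⟨ cong₂ (λ p q → (p + N₁) + q)
             (sum-avoiding k ys′ cs′ (Unique.filter⁺ (λ c → ¬? (c ≟ κ y)) u) a′)
             (sum-avoiding (suc k) ys cs u a) ⟩
      (length cs′ * N₁ + N₁) + length cs * N₂
        ≡⟨ cong (λ l → (length cs′ * N₁ + N₁) + l * N₂) (length-remove u κy∈) ⟩
      (length cs′ * N₁ + N₁) + suc (length cs′) * N₂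
        ≡⟨ collect (length cs′) N₁ N₂ ⟩
      suc (length cs′) * (N₁ + N₂)
        ≡⟨ cong (_* (N₁ + N₂)) (length-remove u κy∈) ⟨
      length cs * (N₁ + N₂)
        ≡⟨ cong (length cs *_) (count-∷ k y ys) ⟨
      length cs * count (suc k) (y ∷ ys) ∎
      where
      open ≡-Reasoning
      cs′ = filter (λ c → ¬? (c ≟ κ y)) cs
      ys′ = filter (R? y) ys
      N₁ = count k ys′
      N₂ = count (suc k) ys
      X = avoided k ys′ cs′
      Y = avoided (suc k) ys cs
      a′ : All (λ z → κ z ∈ cs′) ys′
      a′ = All.tabulate λ z∈ → let z∈ys , r = ∈-filter⁻ (R? y) z∈ in
             ∈-filter⁺ (λ c → ¬? (c ≟ κ y)) (All.lookup a z∈ys) (R⇒≢ r ∘ sym)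
      rearrange : ∀ x y k a b → (x + y) + suc k * (a + b) ≡ (x + k * a + a) + (y + suc k * b)
      rearrange = solve-∀
      collect : ∀ l a b → (l * a + a) + suc l * b ≡ suc l * (a + b)
      collect = solve-∀

    -- A rook in the row blocks exactly its own column of `rest`, so `k` rooks on `rest` leave
    -- `length row` minus `k` places in the row. The term with factor `k` stands on the left to
    -- avoid truncated subtraction.
    count-++-row : ∀ k row rest →
      AllPairs (λ x y → ¬ R x y) row → Unique (map κ row) →
      All (λ z → κ z ∈ map κ row) rest → All (λ x → All (λ z → κ x ≢ κ z → R x z) rest) row →
      count (suc k) (row ++ rest) + k * count k rest ≡ count (suc k) rest + length row * count k rest
    count-++-row k row rest clique unique covers free = begin
      count (suc k) (row ++ rest) + k * N
        ≡⟨ cong (_+ k * N) (count-++-clique k row rest clique) ⟩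
      sum (map (λ x → count k (filter (R? x) rest)) row) + count (suc k) rest + k * N
        ≡⟨ cong (λ l → sum l + count (suc k) rest + k * N) (trans (map-cong-local (All.map same free)) (map-∘ row)) ⟩
      S + count (suc k) rest + k * N
        ≡⟨ move S (count (suc k) rest) (k * N) ⟩
      count (suc k) rest + (S + k * N)
        ≡⟨ cong (λ n → count (suc k) rest + n) (sum-avoiding k rest (map κ row) unique covers) ⟩
      count (suc k) rest + length (map κ row) * N
        ≡⟨ cong (λ l → count (suc k) rest + l * N) (length-map κ row) ⟩
      count (suc k) rest + length row * N ∎
      where
      open ≡-Reasoning
      N = count k rest
      S = avoided k rest (map κ row)
      move : ∀ a b c → a + b + c ≡ b + (a + c)
      move = solve-∀
      filter-cong : ∀ {x zs} → All (λ z → κ x ≢ κ z → R x z) zs → filter (R? x) zs ≡ avoiding (κ x) zs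
      filter-cong [] = refl
      filter-cong {x} {z ∷ zs} (f ∷ fs) with κ x ≟ κ z
      ... | yes e = trans (filter-reject (R? x) (λ r → R⇒≢ r e)) (trans (filter-cong fs)
                      (sym (filter-reject (λ z → ¬? (κ x ≟ κ z)) (λ ne → ne e))))
      ... | no ne = trans (filter-accept (R? x) (f ne)) (trans (cong (z ∷_) (filter-cong fs))
                      (sym (filter-accept (λ z → ¬? (κ x ≟ κ z)) ne)))
      same : ∀ {x} → All (λ z → κ x ≢ κ z → R x z) rest →
             count k (filter (R? x) rest) ≡ count k (avoiding (κ x) rest)
      same f = cong (count k) (filter-cong f)

-- Finite sums and arithmetic of differences

Σ-cong : ∀ {f g : ℕ → ℕ} n → (∀ j → f j ≡ g j) → sum (applyUpTo f n) ≡ sum (applyUpTo g n)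
Σ-cong zero    eq = refl
Σ-cong (suc n) eq = cong₂ _+_ (eq 0) (Σ-cong n (eq ∘ suc))

Σ-zero : ∀ {f : ℕ → ℕ} n → (∀ j → f j ≡ 0) → sum (applyUpTo f n) ≡ 0
Σ-zero zero    eq = refl
Σ-zero (suc n) eq = cong₂ _+_ (eq 0) (Σ-zero n (eq ∘ suc))

Σ-+ : ∀ (f g : ℕ → ℕ) n → sum (applyUpTo (λ j → f j + g j) n) ≡ sum (applyUpTo f n) + sum (applyUpTo g n)
Σ-+ f g zero    = refl
Σ-+ f g (suc n) rewrite Σ-+ (f ∘ suc) (g ∘ suc) n = interchange (f 0) (g 0) (sum (applyUpTo (f ∘ suc) n)) (sum (applyUpTo (g ∘ suc) n))

Σ-*ˡ : ∀ c (f : ℕ → ℕ) n → sum (applyUpTo (λ j → c * f j) n) ≡ c * sum (applyUpTo f n)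
Σ-*ˡ c f zero    = sym (*-zeroʳ c)
Σ-*ˡ c f (suc n) = trans (cong (λ x → c * f 0 + x) (Σ-*ˡ c (f ∘ suc) n)) (sym (*-distribˡ-+ c (f 0) _))

Σ-last : ∀ (f : ℕ → ℕ) n → sum (applyUpTo f (suc n)) ≡ sum (applyUpTo f n) + f n
Σ-last f zero    = +-comm (f 0) 0
Σ-last f (suc n) = trans (cong (λ x → f 0 + x) (Σ-last (f ∘ suc) n)) (sym (+-assoc (f 0) _ (f (suc n))))

nC0≡1 : ∀ n → n C 0 ≡ 1
nC0≡1 n = trans (nCk≡nC[n∸k] {k = 0} {n = n} z≤n) (nCn≡1 n)

1+m-1+n≡m-n : ∀ m n → + suc m - + suc n ≡ + m - + n
1+m-1+n≡m-n m n = trans (ℤ.[1+m]⊖[1+n]≡m⊖n m n) (sym (ℤ.m-n≡m⊖n m n))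

pos-∸ : ∀ {m n} → n ≤ m → + m - + n ≡ + (m ∸ n)
pos-∸ {m} {n} n≤m = trans (ℤ.m-n≡m⊖n m n) (ℤ.⊖-≥ n≤m)

-- Stirling numbers and the Stirling sums

stirling₂-diag : ∀ n → stirling₂ n n ≡ 1
stirling₂-above : ∀ {n r} → n < r → stirling₂ n r ≡ 0

stirling₂-diag zero    = refl
stirling₂-diag (suc n)
  rewrite stirling₂-above (n<1+n n) | stirling₂-diag n | *-zeroʳ n = refl

stirling₂-above {zero}  {suc r} _ = refl
stirling₂-above {suc n} {suc r} (s≤s n<r)
  rewrite stirling₂-above n<r | stirling₂-above (m<n⇒m<1+n n<r) | *-zeroʳ r = refl

stirling-neg : ∀ n r → stirling (+ n) -[1+ r ] ≡ 0
stirling-neg zero    r = refl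
stirling-neg (suc n) r = refl

-- The recurrence at r = m − k, with both sides moved so that no subtraction occurs.
stirling-rec : ∀ n m k →
  stirling (+ suc n) (+ m - + k) + k * stirling (+ n) (+ m - + k) ≡
  stirling (+ n) (+ m - + suc k) + m * stirling (+ n) (+ m - + k)
stirling-rec n zero zero
  rewrite stirling-neg n 0 = refl
stirling-rec n zero (suc k)
  rewrite stirling-neg n k | stirling-neg n (suc k) = *-zeroʳ k
stirling-rec n (suc m) zero
  rewrite +-identityʳ m = rearrange (suc m * stirling₂ n (suc m)) (stirling₂ n m)
  where
  rearrange : ∀ a b → a + b + 0 ≡ b + a
  rearrange = solve-∀
-- Lowering `m` and `k` together keeps their difference and removes one `S` from each side, down to
-- `k = 0`, the defining recurrence, or `m = 0`.
stirling-rec n (suc m) (suc k)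
  rewrite 1+m-1+n≡m-n m k | 1+m-1+n≡m-n m (suc k) = begin
  stirling (+ suc n) (+ m - + k) + suc k * S      ≡⟨ rearrange _ k S ⟩
  stirling (+ suc n) (+ m - + k) + k * S + S      ≡⟨ cong (_+ S) (stirling-rec n m k) ⟩
  stirling (+ n) (+ m - + suc k) + m * S + S      ≡⟨ rearrange _ m S ⟨
  stirling (+ n) (+ m - + suc k) + suc m * S      ∎
  where
  open ≡-Reasoning
  S = stirling (+ n) (+ m - + k)
  rearrange : ∀ a k s → a + suc k * s ≡ a + k * s + s
  rearrange = solve-∀

-- The closed form, with ⌈ m /2⌉ resp. ⌊ m /2⌋ replaced by a free parameter h.
stirlingSum : ℕ → ℕ → ℕ → ℕ
stirlingSum h m k = Σ[0⋯ k ] (λ j → (h C j) * stirling (+ m - + j) (+ m - + k))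

stirlingSum-zeroʳ : ∀ h m → stirlingSum h m 0 ≡ 1
stirlingSum-zeroʳ h m rewrite nC0≡1 h | +-identityʳ m | stirling₂-diag m = refl

stirlingSum-zero : ∀ k → stirlingSum 0 0 (suc k) ≡ 0
stirlingSum-zero k = Σ-zero (suc k) (λ j → refl)

-- Holds term by term, by `stirling-rec` at `m ∸ j`. The sum for `k` is first extended by the
-- vanishing term `j = k + 1`, so that all sums have the same range.
stirlingSum-rec : ∀ h m k → h ≤ m → stirlingSum h (suc m) (suc k) + k * stirlingSum h m k ≡ stirlingSum h m (suc k) + m * stirlingSum h m k
stirlingSum-rec h m k h≤m = begin
  Σ a + k * stirlingSum h m k       ≡⟨ cong (λ x → Σ a + k * x) Σc ⟨
  Σ a + k * Σ c           ≡⟨ cong (λ x → Σ a + x) (Σ-*ˡ k c (suc (suc k))) ⟨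
  Σ a + Σ (λ j → k * c j) ≡⟨ Σ-+ a (λ j → k * c j) (suc (suc k)) ⟨
  Σ (λ j → a j + k * c j) ≡⟨ Σ-cong (suc (suc k)) termwise ⟩
  Σ (λ j → b j + m * c j) ≡⟨ Σ-+ b (λ j → m * c j) (suc (suc k)) ⟩
  Σ b + Σ (λ j → m * c j) ≡⟨ cong (λ x → Σ b + x) (Σ-*ˡ m c (suc (suc k))) ⟩
  Σ b + m * Σ c           ≡⟨ cong (λ x → Σ b + m * x) Σc ⟩
  Σ b + m * stirlingSum h m k       ∎
  where
  open ≡-Reasoning
  Σ : (ℕ → ℕ) → ℕ
  Σ f = sum (applyUpTo f (suc (suc k)))
  a b c : ℕ → ℕ
  a j = (h C j) * stirling (+ suc m - + j) (+ suc m - + suc k)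
  b j = (h C j) * stirling (+ m - + j) (+ m - + suc k)
  c j = (h C j) * stirling (+ m - + j) (+ m - + k)
  distrib : ∀ x y z k → x * y + k * (x * z) ≡ x * (y + k * z)
  distrib = solve-∀
  termwise : ∀ j → a j + k * c j ≡ b j + m * c j
  termwise j with j ≤? m
  -- Here `j > m ≥ h`: the binomial coefficient makes all four terms zero, including those whose
  -- upper Stirling index is negative.
  ... | no j≰m rewrite k>n⇒nCk≡0 (≤-<-trans h≤m (≰⇒> j≰m)) = trans (*-zeroʳ k) (sym (*-zeroʳ m))
  ... | yes j≤m
    rewrite 1+m-1+n≡m-n m k | pos-∸ j≤m | pos-∸ (m≤n⇒m≤1+n j≤m) | +-∸-assoc 1 j≤m =
    trans (distrib (h C j) _ _ k)
      (trans (cong ((h C j) *_) (stirling-rec (m ∸ j) m k)) (sym (distrib (h C j) _ _ m)))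
  c-last : c (suc k) ≡ 0
  c-last with suc k ≤? m
  ... | no k≮m rewrite k>n⇒nCk≡0 (≤-<-trans h≤m (≰⇒> k≮m)) = refl
  -- The upper index `m − k − 1` is below the lower index `m − k`.
  ... | yes k<m rewrite pos-∸ k<m | pos-∸ (<⇒≤ k<m) =
    trans (cong ((h C suc k) *_) (stirling₂-above (∸-monoʳ-< (n<1+n k) k<m))) (*-zeroʳ (h C suc k))
  Σc : Σ c ≡ stirlingSum h m k
  Σc = trans (Σ-last c (suc k)) (trans (cong (λ x → stirlingSum h m k + x) c-last) (+-identityʳ _))

-- Pascal's rule on the terms with positive index. Lowering that index by one also lowers `m + 1`
-- and `k + 1`, which gives the second sum; the terms of index 0 agree because both coefficients are
-- 1.
stirlingSum-pascal : ∀ h m k → stirlingSum (suc h) (suc m) (suc k) ≡ stirlingSum h (suc m) (suc k) + stirlingSum h m k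
stirlingSum-pascal h m k = begin
  (suc h C 0) * s 0 + Σ (λ j → (suc h C suc j) * s (suc j))
    ≡⟨ cong₂ (λ x y → x * s 0 + y) (trans (nC0≡1 (suc h)) (sym (nC0≡1 h))) (Σ-cong (suc k) split) ⟩
  (h C 0) * s 0 + Σ (λ j → f j + g j)
    ≡⟨ cong (λ x → (h C 0) * s 0 + x) (Σ-+ f g (suc k)) ⟩
  (h C 0) * s 0 + (Σ f + Σ g)
    ≡⟨ +-assoc ((h C 0) * s 0) (Σ f) (Σ g) ⟨
  (h C 0) * s 0 + Σ f + Σ g ∎
  where
  open ≡-Reasoning
  Σ : (ℕ → ℕ) → ℕ
  Σ φ = sum (applyUpTo φ (suc k))
  s f g : ℕ → ℕ
  s j = stirling (+ suc m - + j) (+ suc m - + suc k)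
  f j = (h C suc j) * s (suc j)
  g j = (h C j) * stirling (+ m - + j) (+ m - + k)
  split : ∀ j → (suc h C suc j) * s (suc j) ≡ f j + g j
  split j rewrite 1+m-1+n≡m-n m j | 1+m-1+n≡m-n m k | sym (nCk+nC[k+1]≡[n+1]C[k+1] h j) =
    trans (*-distribʳ-+ t (h C j) (h C suc j)) (+-comm ((h C j) * t) ((h C suc j) * t))
    where t = stirling (+ m - + j) (+ m - + k)

-- Diagonals and the spreading map

-- With its converse below, this replaces equal integer differences by equal sums of naturals, on
-- which the case analysis of `spread` computes.
sameDifference⁺ : ∀ i j i′ j′ → i + j′ ≡ i′ + j → + i - + j ≡ + i′ - + j′
sameDifference⁺ i j i′ j′ eq = begin
  + i - + j                        ≡⟨ shift (+ i) (+ j) (+ j′) ⟩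
  (+ i +ℤ + j′) - (+ j +ℤ + j′)    ≡⟨ cong (λ x → + x - (+ j +ℤ + j′)) eq ⟩
  (+ i′ +ℤ + j) - (+ j +ℤ + j′)    ≡⟨ shift′ (+ i′) (+ j) (+ j′) ⟨
  + i′ - + j′                      ∎
  where
  open ≡-Reasoning
  shift : ∀ a b c → a - b ≡ (a +ℤ c) - (b +ℤ c)
  shift = ℤ-solve-∀
  shift′ : ∀ a b c → a - c ≡ (a +ℤ b) - (b +ℤ c)
  shift′ = ℤ-solve-∀

sameDifference⁻ : ∀ i j i′ j′ → + i - + j ≡ + i′ - + j′ → i + j′ ≡ i′ + j
sameDifference⁻ i j i′ j′ eq = ℤ.+-injective (begin
  + i +ℤ + j′                  ≡⟨ shift (+ i) (+ j) (+ j′) ⟩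
  (+ i - + j) +ℤ (+ j +ℤ + j′)  ≡⟨ cong (_+ℤ (+ j +ℤ + j′)) eq ⟩
  (+ i′ - + j′) +ℤ (+ j +ℤ + j′) ≡⟨ shift′ (+ i′) (+ j) (+ j′) ⟨
  + i′ +ℤ + j                  ∎)
  where
  open ≡-Reasoning
  shift : ∀ a b c → a +ℤ c ≡ (a - b) +ℤ (b +ℤ c)
  shift = ℤ-solve-∀
  shift′ : ∀ a b c → a +ℤ b ≡ (a - c) +ℤ (b +ℤ c)
  shift′ = ℤ-solve-∀

Compatible : Square → Square → Set
Compatible s t = ¬ CommonDiagonal s t

compatible? : Decidable Compatible
compatible? s t = ¬? (commonDiagonal? s t)

compatible-sym : ∀ {s t} → Compatible s t → Compatible t s
compatible-sym c (inj₁ eq) = c (inj₁ (sym eq))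
compatible-sym c (inj₂ eq) = c (inj₂ (sym eq))

antidiagonal : Square → ℕ
antidiagonal (i , j) = i + j

-- The difference i − j drops by one if it is ≤ 0 and grows by one otherwise, so
-- that the diagonals i − j = 0 and i − j = 1 are left free.
spread : Square → Square
spread (i , j) with i ≤? j
... | yes _ = i , suc j
... | no  _ = suc i , j

spread-≤ : ∀ {i j} → i ≤ j → spread (i , j) ≡ (i , suc j)
spread-≤ {i} {j} i≤j with i ≤? j
... | yes _   = refl
... | no  i≰j = contradiction i≤j i≰j

spread-> : ∀ {i j} → j < i → spread (i , j) ≡ (suc i , j)
spread-> {i} {j} j<i with i ≤? j
... | yes i≤j = contradiction i≤j (<⇒≱ j<i)
... | no  _   = refl

antidiagonal-spread : ∀ s → antidiagonal (spread s) ≡ suc (antidiagonal s)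
antidiagonal-spread (i , j) with i ≤? j
... | yes _ = +-suc i j
... | no  _ = refl

private
  -- Squares on opposite sides of the cut have differences at most 0 and at least 1, so they never
  -- share a difference-diagonal.
  cross : ∀ {i j i′ j′} → i ≤ j → j′ < i′ → i + j′ < i′ + j
  cross {i} {j} {i′} {j′} i≤j j′<i′ =
    subst (i + j′ <_) (+-comm j i′) (+-mono-≤-< i≤j j′<i′)

spread-preserves-difference : ∀ i j i′ j′ → i + j′ ≡ i′ + j →
  proj₁ (spread (i , j)) + proj₂ (spread (i′ , j′)) ≡ proj₁ (spread (i′ , j′)) + proj₂ (spread (i , j))
spread-preserves-difference i j i′ j′ eq with i ≤? j | i′ ≤? j′
... | yes _   | yes _     = trans (+-suc i j′) (trans (cong suc eq) (sym (+-suc i′ j)))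
... | yes i≤j | no  i′≰j′ = contradiction eq (<⇒≢ (cross i≤j (≰⇒> i′≰j′)))
... | no  i≰j | yes i′≤j′ = contradiction (sym eq) (<⇒≢ (cross i′≤j′ (≰⇒> i≰j)))
... | no  _   | no  _     = cong suc eq

spread-reflects-difference : ∀ i j i′ j′ →
  proj₁ (spread (i , j)) + proj₂ (spread (i′ , j′)) ≡ proj₁ (spread (i′ , j′)) + proj₂ (spread (i , j)) →
  i + j′ ≡ i′ + j
spread-reflects-difference i j i′ j′ eq with i ≤? j | i′ ≤? j′
... | yes _   | yes _     = suc-injective (trans (sym (+-suc i j′)) (trans eq (+-suc i′ j)))
... | yes i≤j | no  i′≰j′ = contradiction eq (<⇒≢ (cross (m≤n⇒m≤1+n i≤j) (m<n⇒m<1+n (≰⇒> i′≰j′))))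
... | no  i≰j | yes i′≤j′ = contradiction (sym eq) (<⇒≢ (cross (m≤n⇒m≤1+n i′≤j′) (m<n⇒m<1+n (≰⇒> i≰j))))
... | no  _   | no  _     = suc-injective eq

spread-preserves : ∀ {s t} → CommonDiagonal s t → CommonDiagonal (spread s) (spread t)
spread-preserves {i , j} {i′ , j′} (inj₁ eq) = inj₁ (sameDifference⁺ (proj₁ (spread (i , j))) _ (proj₁ (spread (i′ , j′))) _
  (spread-preserves-difference i j i′ j′ (sameDifference⁻ i j i′ j′ eq)))
spread-preserves {s} {t} (inj₂ eq) =
  inj₂ (trans (antidiagonal-spread s) (trans (cong suc eq) (sym (antidiagonal-spread t))))

spread-reflects : ∀ {s t} → CommonDiagonal (spread s) (spread t) → CommonDiagonal s t
spread-reflects {i , j} {i′ , j′} (inj₁ eq) = inj₁ (sameDifference⁺ i j i′ j′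
  (spread-reflects-difference i j i′ j′ (sameDifference⁻ (proj₁ (spread (i , j))) _ (proj₁ (spread (i′ , j′))) _ eq)))
spread-reflects {s} {t} (inj₂ eq) =
  inj₂ (suc-injective (trans (sym (antidiagonal-spread s)) (trans eq (antidiagonal-spread t))))

-- A square is determined by its sum and its difference, and `spread` reflects equality of both.
spread-injective : ∀ {s t} → spread s ≡ spread t → s ≡ t
spread-injective {i , j} {i′ , j′} eq = cong₂ _,_ i≡i′ (+-cancelˡ-≡ i j j′ (trans sums (cong (_+ j′) (sym i≡i′))))
  where
  sums : i + j ≡ i′ + j′
  sums = suc-injective (trans (sym (antidiagonal-spread (i , j))) (trans (cong antidiagonal eq) (antidiagonal-spread (i′ , j′))))
  differences : i + j′ ≡ i′ + j
  differences = spread-reflects-difference i j i′ j′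
    (cong₂ _+_ (cong proj₁ eq) (cong proj₂ (sym eq)))
  double : i + i ≡ i′ + i′
  double = +-cancelʳ-≡ (j + j′) (i + i) (i′ + i′) (trans (mix i j j′) (trans (cong₂ _+_ sums differences) (mix′ i′ j j′)))
    where
    mix : ∀ a b c → a + a + (b + c) ≡ (a + b) + (a + c)
    mix = solve-∀
    mix′ : ∀ a b c → (a + c) + (a + b) ≡ a + a + (b + c)
    mix′ = solve-∀
  i≡i′ : i ≡ i′
  i≡i′ = *-cancelˡ-≡ i i′ 2 (trans (twice i) (trans double (sym (twice i′))))
    where
    twice : ∀ a → 2 * a ≡ a + a
    twice = solve-∀

-- Differences after spreading are at most -1 or at least 2.
spread-misses : ∀ {e} → e ≤ 1 → ∀ s → proj₁ (spread s) ≢ e + proj₂ (spread s)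
spread-misses {e} e≤1 (i , j) eq with i ≤? j
... | yes i≤j = contradiction eq (<⇒≢ (≤-trans (s≤s i≤j) (m≤n+m (suc j) e)))
... | no  i≰j = contradiction eq (>⇒≢ (s≤s (≤-trans (+-monoˡ-≤ j e≤1) (≰⇒> i≰j))))

-- Cutting a colour class along a difference-diagonal

line : ℕ → ℕ → List Square
line e = applyUpTo (λ a → e + suc a , suc a)

∈-squares⁺ : ∀ {m i j} → i < m → j < m → (suc i , suc j) ∈ squares m
∈-squares⁺ i<m j<m = ∈-cartesianProduct⁺ (∈-applyUpTo⁺ suc i<m) (∈-applyUpTo⁺ suc j<m)

∈-squares⁻ : ∀ m {s} → s ∈ squares m → ∃[ i ] ∃[ j ] (i < m × j < m × s ≡ (suc i , suc j))
∈-squares⁻ m s∈ with ∈-cartesianProduct⁻ (applyUpTo suc m) (applyUpTo suc m) s∈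
... | x∈ , y∈ with ∈-applyUpTo⁻ suc x∈ | ∈-applyUpTo⁻ suc y∈
...   | i , i<m , refl | j , j<m , refl = i , j , i<m , j<m , refl

squares-unique : ∀ m → Unique (squares m)
squares-unique m = Unique.cartesianProduct⁺ unique unique
  where
  unique : Unique (applyUpTo suc m)
  unique = Unique.applyUpTo⁺₁ suc m (λ i<j _ → <⇒≢ i<j ∘ suc-injective)

-- `P` is the colour on the larger board and `Q` the opposite colour on the smaller one. Of the two
-- diagonals that `spread` frees, only the one with difference `e` carries the colour `P`; it has
-- `n` squares. `Q-sum` says that the antidiagonal of a spread square has the right parity to meet
-- it.
module _ {P Q : Square → Set} (P? : U.Decidable P) (Q? : U.Decidable Q)
         (e : ℕ) (e≤1 : e ≤ 1)
         (P-line : ∀ j → P (e + j , j))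
         (P₀⇒e≡0 : ∀ {i} → P (i , i) → e ≡ 0) (P₁⇒e≡1 : ∀ {i} → P (suc i , i) → e ≡ 1)
         (Q⇒Pˡ : ∀ {i j} → Q (i , j) → P (suc i , j)) (Q⇒Pʳ : ∀ {i j} → Q (i , j) → P (i , suc j))
         (Pˡ⇒Q : ∀ {i j} → P (suc i , j) → Q (i , j)) (Pʳ⇒Q : ∀ {i j} → P (i , suc j) → Q (i , j))
         (Q-sum : ∀ {i j} → Q (i , j) → ∃[ a ] suc (i + j) ≡ e + (a + a))
         (m n : ℕ) (e+n≡1+m : e + n ≡ suc m) where

  private
    board = filter P? (squares (suc m))
    inner = filter Q? (squares m)
    rest  = map spread inner

    spread-∈ : ∀ {t} → t ∈ inner → spread t ∈ board
    spread-∈ t∈ with ∈-filter⁻ Q? {xs = squares m} t∈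
    ... | t∈sq , q with ∈-squares⁻ m t∈sq
    ...   | i , j , i<m , j<m , refl with suc i ≤? suc j
    ...     | yes _ = ∈-filter⁺ P? (∈-squares⁺ (m<n⇒m<1+n i<m) (s≤s j<m)) (Q⇒Pʳ q)
    ...     | no  _ = ∈-filter⁺ P? (∈-squares⁺ (s≤s i<m) (m<n⇒m<1+n j<m)) (Q⇒Pˡ q)

    line-∈ : ∀ {s} → s ∈ line e n → s ∈ board
    line-∈ s∈ with ∈-applyUpTo⁻ _ s∈
    ... | a , a<n , refl = ∈-filter⁺ P?
      (subst (λ x → (x , suc a) ∈ squares (suc m)) (sym (+-suc e a))
        (∈-squares⁺ (subst (e + a <_) e+n≡1+m (+-monoʳ-< e a<n))
                    (≤-trans a<n (≤-trans (m≤n+m n e) (≤-reflexive e+n≡1+m)))))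
      (P-line (suc a))

    -- Above the diagonal, or at least two below it, `spread` is undone by lowering the larger
    -- coordinate. For difference 0 or 1 the colour forces the difference to be `e`, so the square
    -- is on the line.
    cover : ∀ {s} → s ∈ board → s ∈ line e n ++ rest
    cover s∈ with ∈-filter⁻ P? {xs = squares (suc m)} s∈
    ... | s∈sq , p with ∈-squares⁻ (suc m) s∈sq
    ...   | i , j , i<m , j<m , refl with <-cmp i j
    ...     | tri< i<j@(s≤s _) _ _ = ∈-++⁺ʳ (line e n) (subst (_∈ rest) (spread-≤ i<j)
                (∈-map⁺ spread (∈-filter⁺ Q? (∈-squares⁺ (≤-trans i<j (≤-pred j<m)) (≤-pred j<m)) (Pʳ⇒Q p))))
    ...     | tri≈ _ refl _ with P₀⇒e≡0 p
    ...       | refl = ∈-++⁺ˡ (∈-applyUpTo⁺ _ (subst (i <_) (sym e+n≡1+m) i<m))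
    cover s∈ | s∈sq , p | i , j , i<m , j<m , refl | tri> _ _ j<i with m≤n⇒m<n∨m≡n j<i
    ... | inj₂ refl with P₁⇒e≡1 p
    ...   | refl = ∈-++⁺ˡ (∈-applyUpTo⁺ _ (subst (j <_) (sym (suc-injective e+n≡1+m)) (≤-pred i<m)))
    cover s∈ | s∈sq , p | suc i , j , i<m , j<m , refl | tri> _ _ j<i | inj₁ j+1<i =
      ∈-++⁺ʳ (line e n) (subst (_∈ rest) (spread-> j+1<i)
        (∈-map⁺ spread (∈-filter⁺ Q? (∈-squares⁺ (≤-pred i<m) (≤-trans j<i (≤-pred i<m))) (Pˡ⇒Q p))))

    -- Both lists are duplicate-free and have the same members.
    board-↭ : board ↭ line e n ++ rest
    board-↭ = ∼bag⇒↭ (unique∧set⇒bag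
      (Unique.filter⁺ P? (squares-unique (suc m)))
      (Unique.++⁺
        (Unique.applyUpTo⁺₁ _ n (λ i<j _ → <⇒≢ i<j ∘ suc-injective ∘ cong proj₂))
        (Unique.map⁺ spread-injective (Unique.filter⁺ Q? (squares-unique m)))
        disjoint)
      (mk⇔ cover (λ s∈ → [ line-∈ , image-∈ ]′ (∈-++⁻ (line e n) s∈))))
      where
      image-∈ : ∀ {s} → s ∈ rest → s ∈ board
      image-∈ s∈ with ∈-map⁻ spread s∈
      ... | t , t∈ , refl = spread-∈ t∈
      disjoint : ∀ {s} → ¬ (s ∈ line e n × s ∈ rest)
      disjoint (s∈line , s∈rest) with ∈-applyUpTo⁻ _ s∈line | ∈-map⁻ spread s∈rest
      ... | a , _ , refl | t , _ , eq =
        spread-misses e≤1 t (subst (λ s → proj₁ s ≡ e + proj₂ s) eq refl)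

    covers : All (λ z → antidiagonal z ∈ map antidiagonal (line e n)) rest
    covers = All.tabulate covered
      where
      open ≤-Reasoning
      bound : ∀ {i j a} → i < m → j < m → suc (suc i + suc j) ≡ e + (suc a + suc a) → a < n
      bound {i} {j} {a} i<m j<m eq with a <? n
      ... | yes a<n = a<n
      -- A spread square has sum at most `2m + 1`, whereas `a ≥ n` would make it at least
      -- `e + 2n + 1`, hence at least `2(e + n) = 2(m + 1)`.
      ... | no  a≮n = contradiction eq (<⇒≢ (begin-strict
        suc (suc i + suc j)         ≤⟨ s≤s (+-mono-≤ i<m j<m) ⟩
        suc (m + m)                 <⟨ ≤-reflexive (double-suc m) ⟩
        suc m + suc m               ≡⟨ cong₂ _+_ e+n≡1+m e+n≡1+m ⟨
        (e + n) + (e + n)           ≤⟨ +-monoʳ-≤ (e + n) (+-monoˡ-≤ n e≤1) ⟩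
        (e + n) + suc n             ≡⟨ +-assoc e n (suc n) ⟩
        e + (n + suc n)             ≤⟨ +-monoʳ-≤ e (+-mono-≤ (m≤n⇒m≤1+n (≮⇒≥ a≮n)) (s≤s (≮⇒≥ a≮n))) ⟩
        e + (suc a + suc a)         ∎))
        where
        double-suc : ∀ m → suc (suc (m + m)) ≡ suc m + suc m
        double-suc = solve-∀
      covered : ∀ {z} → z ∈ rest → antidiagonal z ∈ map antidiagonal (line e n)
      covered z∈ with ∈-map⁻ spread z∈
      ... | t , t∈ , refl with ∈-filter⁻ Q? {xs = squares m} t∈
      ...   | t∈sq , q with ∈-squares⁻ m t∈sq
      ...     | i , j , i<m , j<m , refl with Q-sum q
      -- Coordinates start at 1, so the spread sum is at least 3, but this case would make it `e`.
      ...       | zero , eq = contradiction eq (>⇒≢ (≤-trans (s≤s (≤-trans (≤-reflexive (+-identityʳ e)) e≤1)) (s≤s (s≤s z≤n))))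
      ...       | suc a , eq = subst (_∈ map antidiagonal (line e n))
        (trans (+-assoc e (suc a) (suc a)) (trans (sym eq) (sym (antidiagonal-spread (suc i , suc j)))))
        (∈-map⁺ antidiagonal (∈-applyUpTo⁺ _ (bound i<m j<m eq)))

  -- The removed line is the row of `count-++-row` and the antidiagonals are the columns; `spread`
  -- carries the count on `rest` back to `inner`.
  placements-rec : ∀ k →
    placements board (suc k) + k * placements inner k ≡ placements inner (suc k) + n * placements inner k
  placements-rec k = begin
    count compatible? (suc k) board + k * count compatible? k inner
      ≡⟨ cong₂ (λ x y → x + k * y) (count-↭ compatible? (λ {s} {t} → compatible-sym {s} {t}) (suc k) board-↭) (sym (mapped k)) ⟩
    count compatible? (suc k) (line e n ++ rest) + k * count compatible? k rest
      ≡⟨ count-++-row compatible? antidiagonal (λ c → c ∘ inj₂) k (line e n) rest clique unique covers free ⟩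
    count compatible? (suc k) rest + length (line e n) * count compatible? k rest
      ≡⟨ cong₂ _+_ (mapped (suc k)) (cong₂ _*_ (length-applyUpTo _ n) (mapped k)) ⟩
    count compatible? (suc k) inner + n * count compatible? k inner ∎
    where
    open ≡-Reasoning
    mapped : ∀ k → count compatible? k rest ≡ count compatible? k inner
    mapped k = count-map compatible? spread (λ {s} {t} c → c ∘ spread-preserves {s} {t})
      (λ {s} {t} c → c ∘ spread-reflects {s} {t}) k inner
    clique : AllPairs (λ s t → ¬ Compatible s t) (line e n)
    clique = AllPairs.applyUpTo⁺₂ _ n (λ a b c → c (inj₁ (sameDifference⁺ (e + suc a) (suc a) (e + suc b) (suc b) (xy∙z≈xz∙y e (suc a) (suc b)))))
    unique : Unique (map antidiagonal (line e n))
    unique = subst Unique (sym (map-applyUpTo _ antidiagonal n))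
      (Unique.applyUpTo⁺₁ _ n (λ i<j _ → <⇒≢ (+-mono-<-≤ (+-monoʳ-< e (s≤s i<j)) (s≤s (<⇒≤ i<j)))))
    -- By `spread-misses` no spread square shares a difference-diagonal with the line, so only a
    -- common antidiagonal can attack.
    free : All (λ x → All (λ z → antidiagonal x ≢ antidiagonal z → Compatible x z) rest) (line e n)
    free = All.tabulate λ x∈ → All.tabulate λ z∈ → compatible x∈ z∈
      where
      compatible : ∀ {x z} → x ∈ line e n → z ∈ rest → antidiagonal x ≢ antidiagonal z → Compatible x z
      compatible x∈ z∈ ne (inj₂ eq) = ne eq
      compatible x∈ z∈ ne (inj₁ eq) with ∈-applyUpTo⁻ _ x∈ | ∈-map⁻ spread z∈
      ... | a , _ , refl | t , _ , refl = spread-misses e≤1 t (+-cancelʳ-≡ (suc a) _ _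
        (trans (sym (sameDifference⁻ (e + suc a) (suc a) (proj₁ (spread t)) (proj₂ (spread t)) eq))
               (xy∙z≈xz∙y e (suc a) (proj₂ (spread t)))))

-- Parity and the two-colour recurrences

2∤1+ : ∀ {n} → 2 ∣ n → ¬ (2 ∣ suc n)
2∤1+ {n} 2∣n 2∣1+n with ∣1⇒≡1 (∣m+n∣m⇒∣n {2} {n} {1} (subst (2 ∣_) (+-comm 1 n) 2∣1+n) 2∣n)
... | ()

2∣1+ : ∀ {n} → ¬ (2 ∣ n) → 2 ∣ suc n
2∣1+ {zero}        2∤0 = contradiction (2 ∣0) 2∤0
2∣1+ {suc zero}    _   = ∣-refl
2∣1+ {suc (suc n)} 2∤n = ∣m∣n⇒∣m+n ∣-refl (2∣1+ {n} (2∤n ∘ ∣m∣n⇒∣m+n ∣-refl))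

2∤1+⇒2∣ : ∀ {n} → ¬ (2 ∣ suc n) → 2 ∣ n
2∤1+⇒2∣ {n} 2∤1+n with 2 ∣? n
... | yes 2∣n = 2∣n
... | no  2∤n = contradiction (2∣1+ 2∤n) 2∤1+n

halve : ∀ {n} → 2 ∣ n → ∃[ a ] n ≡ a + a
halve (divides a eq) = a , trans eq (twice a)
  where
  twice : ∀ a → a * 2 ≡ a + a
  twice = solve-∀

2∣a+a : ∀ a → 2 ∣ a + a
2∣a+a a = divides a (twice a)
  where
  twice : ∀ a → a + a ≡ a * 2
  twice = solve-∀

-- The diagonal `i = j` is white and has `m + 1` squares.
R-W-rec : ∀ m k → R-W (suc m) (suc k) + k * R-K m k ≡ R-K m (suc k) + suc m * R-K m k
R-W-rec m = placements-rec even? odd? 0 z≤n 2∣a+a (λ _ → refl)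
  (λ {i} p → contradiction p (2∤1+ (2∣a+a i)))
  2∣1+ (λ {i} {j} q → subst (2 ∣_) (sym (+-suc i j)) (2∣1+ q))
  (λ p q → 2∤1+ q p) (λ {i} {j} p q → 2∤1+ q (subst (2 ∣_) (+-suc i j) p))
  (λ q → halve (2∣1+ q)) m (suc m) refl

-- The diagonal `i = j + 1` is black and has `m` squares.
R-K-rec : ∀ m k → R-K (suc m) (suc k) + k * R-W m k ≡ R-W m (suc k) + m * R-W m k
R-K-rec m = placements-rec odd? even? 1 ≤-refl (λ j → 2∤1+ (2∣a+a j))
  (λ {i} p → contradiction (2∣a+a i) p) (λ _ → refl)
  2∤1+ (λ {i} {j} q → 2∤1+ q ∘ subst (2 ∣_) (+-suc i j))
  2∤1+⇒2∣ (λ {i} {j} p → 2∤1+⇒2∣ (p ∘ subst (2 ∣_) (sym (+-suc i j))))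
  (λ q → let a , eq = halve q in a , cong suc eq) m m refl

-- Closed forms

-- Mutual induction, each colour using the other on the smaller board. By computation `⌈ suc m /2⌉`
-- is `suc ⌊ m /2⌋`, so the white step needs Pascal's rule, which absorbs the extra `a` from the
-- factor `suc m`; `⌊ suc m /2⌋` is `⌈ m /2⌉`, so the black step keeps `h`.
R-W-closed : ∀ m k → R-W m k ≡ stirlingSum ⌈ m /2⌉ m k
R-K-closed : ∀ m k → R-K m k ≡ stirlingSum ⌊ m /2⌋ m k

R-W-closed m       zero    = sym (stirlingSum-zeroʳ ⌈ m /2⌉ m)
R-W-closed zero    (suc k) = sym (stirlingSum-zero k)
R-W-closed (suc m) (suc k) = +-cancelʳ-≡ (k * a) _ _ (begin
  R-W (suc m) (suc k) + k * a                 ≡⟨ cong (λ x → R-W (suc m) (suc k) + k * x) (R-K-closed m k) ⟨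
  R-W (suc m) (suc k) + k * R-K m k           ≡⟨ R-W-rec m k ⟩
  R-K m (suc k) + suc m * R-K m k             ≡⟨ cong₂ (λ x y → x + suc m * y) (R-K-closed m (suc k)) (R-K-closed m k) ⟩
  stirlingSum h m (suc k) + suc m * a         ≡⟨ rearrange (stirlingSum h m (suc k)) a m ⟩
  stirlingSum h m (suc k) + m * a + a         ≡⟨ cong (λ x → x + a) (stirlingSum-rec h m k (⌊n/2⌋≤n m)) ⟨
  stirlingSum h (suc m) (suc k) + k * a + a   ≡⟨ xy∙z≈xz∙y (stirlingSum h (suc m) (suc k)) (k * a) a ⟩
  stirlingSum h (suc m) (suc k) + a + k * a   ≡⟨ cong (λ x → x + k * a) (stirlingSum-pascal h m k) ⟨
  stirlingSum (suc h) (suc m) (suc k) + k * a ∎)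
  where
  open ≡-Reasoning
  h = ⌊ m /2⌋
  a = stirlingSum h m k
  rearrange : ∀ x a m → x + suc m * a ≡ x + m * a + a
  rearrange = solve-∀

R-K-closed m       zero    = sym (stirlingSum-zeroʳ ⌊ m /2⌋ m)
R-K-closed zero    (suc k) = sym (stirlingSum-zero k)
R-K-closed (suc m) (suc k) = +-cancelʳ-≡ (k * a) _ _ (begin
  R-K (suc m) (suc k) + k * a                 ≡⟨ cong (λ x → R-K (suc m) (suc k) + k * x) (R-W-closed m k) ⟨
  R-K (suc m) (suc k) + k * R-W m k           ≡⟨ R-K-rec m k ⟩
  R-W m (suc k) + m * R-W m k                 ≡⟨ cong₂ (λ x y → x + m * y) (R-W-closed m (suc k)) (R-W-closed m k) ⟩
  stirlingSum h m (suc k) + m * a             ≡⟨ stirlingSum-rec h m k (⌈n/2⌉≤n m) ⟨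
  stirlingSum h (suc m) (suc k) + k * a       ∎)
  where
  open ≡-Reasoning
  h = ⌈ m /2⌉
  a = stirlingSum h m k

R-W≡R-K : ∀ {m} → 2 ∣ m → ∀ k → R-W m k ≡ R-K m k
R-W≡R-K {m} 2∣m k = trans (R-W-closed m k) (trans (cong (λ h → stirlingSum h m k) (halves 2∣m)) (sym (R-K-closed m k)))
  where
  halves : ∀ {m} → 2 ∣ m → ⌈ m /2⌉ ≡ ⌊ m /2⌋
  halves 2∣m with halve 2∣m
  ... | a , refl = trans (sym (n≡⌈n+n/2⌉ a)) (n≡⌊n+n/2⌋ a)

-- Recurrences within one colour

-- Moves the `k`-fold term across in the integers; `c` is left free to match the coefficient written
-- with `π`.
solve-for : ∀ {x y z c} n k → + n - + k ≡ c → x + k * z ≡ y + n * z → + x ≡ + y +ℤ c *ℤ + z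
solve-for {x} {y} {z} n k refl eq = begin
  + x                                           ≡⟨ add (+ x) (+ k) (+ z) ⟩
  (+ x +ℤ + k *ℤ + z) - + k *ℤ + z              ≡⟨ cong (λ w → (+ x +ℤ w) - + k *ℤ + z) (ℤ.pos-* k z) ⟨
  + (x + k * z) - + k *ℤ + z                    ≡⟨ cong (λ w → + w - + k *ℤ + z) eq ⟩
  + (y + n * z) - + k *ℤ + z                    ≡⟨ cong (λ w → (+ y +ℤ w) - + k *ℤ + z) (ℤ.pos-* n z) ⟩
  (+ y +ℤ + n *ℤ + z) - + k *ℤ + z              ≡⟨ collect (+ y) (+ n) (+ k) (+ z) ⟩
  + y +ℤ (+ n - + k) *ℤ + z                     ∎
  where
  open ≡-Reasoning
  add : ∀ x k z → x ≡ (x +ℤ k *ℤ z) - k *ℤ z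
  add = ℤ-solve-∀
  collect : ∀ y n k z → (y +ℤ n *ℤ z) - k *ℤ z ≡ y +ℤ (n - k) *ℤ z
  collect = ℤ-solve-∀

π-even : ∀ {m} → 2 ∣ m → π m ≡ 0
π-even {m} 2∣m = cong (λ b → if b then 0 else 1) (dec-true (2 ∣? m) 2∣m)

π-odd : ∀ {m} → ¬ (2 ∣ m) → π m ≡ 1
π-odd {m} 2∤m = cong (λ b → if b then 0 else 1) (dec-false (2 ∣? m) 2∤m)

1+m-n≡1+m-1+n+1 : ∀ m k → + suc m - + k ≡ + suc m - + suc k +ℤ + 1
1+m-n≡1+m-1+n+1 m k = shift (+ 1) (+ m) (+ k)
  where
  shift : ∀ o a b → (o +ℤ a) - b ≡ (o +ℤ a) - (o +ℤ b) +ℤ o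
  shift = ℤ-solve-∀

recurrences : ∀ m k →
  (+ R-W (suc m) (suc k) ≡ + R-W m (suc k) +ℤ (+ suc m - + suc k +ℤ + π (suc m)) *ℤ + R-W m k)
  × (+ R-K (suc m) (suc k) ≡ + R-K m (suc k) +ℤ (+ suc m - + suc k +ℤ + 1 - + π (suc m)) *ℤ + R-K m k)
recurrences m k with 2 ∣? m
-- The smaller board has even size, so the colours are interchanged there.
... | yes 2∣m rewrite π-odd (2∤1+ 2∣m) =
    solve-for (suc m) k (1+m-n≡1+m-1+n+1 m k)
      (trans (cong (λ x → R-W (suc m) (suc k) + k * x) (R-W≡R-K 2∣m k)) (trans (R-W-rec m k)
        (sym (cong₂ (λ x y → x + suc m * y) (R-W≡R-K 2∣m (suc k)) (R-W≡R-K 2∣m k)))))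
  , solve-for m k (trans (sym (1+m-1+n≡m-n m k)) (cancel (+ suc m - + suc k)))
      (trans (cong (λ x → R-K (suc m) (suc k) + k * x) (sym (R-W≡R-K 2∣m k))) (trans (R-K-rec m k)
        (cong₂ (λ x y → x + m * y) (R-W≡R-K 2∣m (suc k)) (R-W≡R-K 2∣m k))))
  where
  cancel : ∀ x → x ≡ x +ℤ + 1 - + 1
  cancel = ℤ-solve-∀
-- Now the larger board has even size, so the colours are interchanged on the left-hand side.
... | no  2∤m rewrite π-even (2∣1+ 2∤m) =
    solve-for m k (trans (sym (1+m-1+n≡m-n m k)) (sym (ℤ.+-identityʳ _)))
      (trans (cong (λ x → x + k * R-W m k) (R-W≡R-K (2∣1+ 2∤m) (suc k))) (R-K-rec m k))
  , solve-for (suc m) k (trans (1+m-n≡1+m-1+n+1 m k) (sym (ℤ.+-identityʳ _)))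
      (trans (cong (λ x → x + k * R-K m k) (sym (R-W≡R-K (2∣1+ 2∤m) (suc k)))) (R-W-rec m k))

theorem2p2 : (∀ (m k : ℕ) → 1 ≤ m → 1 ≤ k →
    (+ R-W m k ≡ + R-W (m ∸ 1) k +ℤ (+ m - + k +ℤ + π m) *ℤ + R-W (m ∸ 1) (k ∸ 1))
    × (+ R-K m k ≡ + R-K (m ∸ 1) k +ℤ (+ m - + k +ℤ + 1 - + π m) *ℤ + R-K (m ∸ 1) (k ∸ 1)))
    × (∀ (m : ℕ) → (R-W m 0 ≡ 1) × (R-K m 0 ≡ 1))
    × (∀ (k : ℕ) → (R-W 0 k ≡ δ k 0) × (R-K 0 k ≡ δ k 0))
    × (∀ (m k : ℕ) →
    (R-W m k ≡ Σ[0⋯ k ] (λ j → (⌈ m /2⌉ C j) * stirling (+ m - + j) (+ m - + k)))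
    × (R-K m k ≡ Σ[0⋯ k ] (λ j → (⌊ m /2⌋ C j) * stirling (+ m - + j) (+ m - + k))))
theorem2p2 =
    (λ { (suc m) (suc k) _ _ → recurrences m k })
  , (λ m → refl , refl)
  , (λ { zero → refl , refl ; (suc k) → refl , refl })
  , (λ m k → R-W-closed m k , R-K-closed m k)
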